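{- Let $n\ge 2$, let $F$ be a field of order greater than $2$, and let $\Sigma_n$ be the $n$-dimensional projective space over $F$. Let $A=\{A_1,\ldots,A_{n+1}\}$ and $B=\{B_1,\ldots,B_{n+1}\}$ be two simplexes in $\Sigma_n$ in perspective from a vertex $V$ (with $A_i$ corresponding to $B_i$) which have no common points or faces. Then: (a) The intersection points of corresponding edges of $A$ and $B$ form a set $S$ of $\binom{n+1}{2}$ distinct points in $\Sigma_n$. None of these points lies in $A$ or in $B$ or is equal to $V$. (b) The intersection of corresponding $t$-spaces of $A,B$ is a $(t-1)$-dimensional subspace of $\Sigma_n$ for $t=1,2,\ldots,n-1$. (c) There is a fixed hyperplane $v$ of $\Sigma_n$ such that the intersection of any two corresponding faces of $A,B$ is an $(n-2)$-dimensional subspace which lies in $v$. (d) In particular, the set $S$ lies in $v$.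
   Context: Dimension means projective dimension. A simplex in $\Sigma_n$ is a set of $n+1$ points that generates $\Sigma_n$. An edge is the line joining two points of a simplex; a face is a hyperplane generated by $n$ of its points. $A,B$ are in perspective from the vertex (point) $V$ if there are $n+1$ lines through $V$, the $i$-th one containing $A_i$ and $B_i$, for $i=1,\ldots,n+1$. A $t$-space of $A$ is the $t$-dimensional subspace generated by $t+1$ points $A_i$, $i\in I$, $|I|=t+1$; the corresponding $t$-space of $B$ is generated by the points $B_i$, $i\in I$. Corresponding edges are the case $t=1$ and corresponding faces the case $t=n-1$.
   Formalization: The vertex V is assumed not to be a point of A or of B; otherwise (a) fails, since if V = A_i the edge A_iA_j contains B_j, so corresponding edges meet in a point of B. Equality in the field F is assumed decidable, which holds classically for every field. -}

module Defs where

open import Algebra.Apartness.Bundles using (HeytingCommutativeRing; HeytingField)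
open import Algebra.Bundles using (CommutativeRing)
import Algebra.Properties.CommutativeMonoid.Sum as Sum
import Algebra.Properties.Ring as RingProperties
open import Data.Fin.Base using (Fin)
open import Data.Fin.Subset using (Subset; _∈_; ∣_∣)
open import Data.Nat.Base using (ℕ; suc)
open import Data.Product.Base using (∃; _×_; _,_; proj₁; proj₂)
open import Data.Vec.Functional using (Vector; map; zipWith; replicate)
import Data.Vec.Functional.Relation.Binary.Equality.Setoid as VecEquality
open import Function.Bundles using (Bijection; Injection)
open import Function.Definitions using (Injective)
open import Level using (_⊔_) renaming (suc to lsuc)
open import Relation.Binary.Bundles using (Setoid)
import Relation.Binary.Construct.On as On
open import Relation.Binary.PropositionalEquality.Core using (_≡_)
open import Relation.Binary.PropositionalEquality.Properties
  using () renaming (setoid to ≡-setoid)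
import Relation.Binary.Reasoning.Setoid as SetoidReasoning
open import Relation.Nullary.Negation.Core using (¬_)
open import Relation.Unary using (Pred)

OrderGreaterThan2 : ∀ {c ℓ₁ ℓ₂} → HeytingField c ℓ₁ ℓ₂ → Set (c ⊔ ℓ₁)
OrderGreaterThan2 F = Injection (≡-setoid (Fin 3)) (HeytingField.setoid F)

-- The n-dimensional projective space over F: points are nonzero vectors of
-- F^(n+1) up to a nonzero scalar, and projective subspaces are linear
-- subspaces of F^(n+1).
module ProjectiveSpace {c ℓ₁ ℓ₂} (F : HeytingField c ℓ₁ ℓ₂) (n : ℕ) where

  open HeytingField F
  open CommutativeRing
    (HeytingCommutativeRing.commutativeRing heytingCommutativeRing)
    using (ring; +-commutativeMonoid)
  open VecEquality setoid using (_≋_)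
  open Sum +-commutativeMonoid using (sum)

  𝕍 : Set c
  𝕍 = Vector Carrier (suc n)

  0ᵛ : 𝕍
  0ᵛ = replicate (suc n) 0#

  infixl 6 _+ᵛ_
  infixr 7 _·_

  _+ᵛ_ : 𝕍 → 𝕍 → 𝕍
  _+ᵛ_ = zipWith _+_

  _·_ : Carrier → 𝕍 → 𝕍
  a · v = map (a *_) v

  record Point : Set (c ⊔ ℓ₁) where
    constructor point
    field
      vec     : 𝕍
      nonzero : ¬ (vec ≋ 0ᵛ)

  open Point public

  infix 4 _≈ₚ_ _∈ₚ_ _⊑_ _≐_

  _≈ₚ_ : Point → Point → Set (c ⊔ ℓ₁ ⊔ ℓ₂)
  P ≈ₚ Q = ∃ λ a → a # 0# × vec P ≋ a · vec Q

  private
    invertible : ∀ {a} → a # 0# → ∃ λ b → b * a ≈ 1# × a * b ≈ 1#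
    invertible {a} a#0 with #⇒invertible a#0
    ... | b , l , r =
      b , trans (*-congˡ (sym a-0≈a)) l , trans (*-congʳ (sym a-0≈a)) r
      where
      a-0≈a : a - 0# ≈ a
      a-0≈a = trans (+-congˡ (RingProperties.-0#≈0# ring)) (+-identityʳ a)

    unit⇒# : ∀ {a b} → b * a ≈ 1# → a # 0#
    unit⇒# {a} {b} ba≈1 = invertible⇒#
      ( b
      , trans (*-congˡ a-0≈a) ba≈1
      , trans (*-congʳ a-0≈a) (trans (*-comm a b) ba≈1))
      where
      a-0≈a : a - 0# ≈ a
      a-0≈a = trans (+-congˡ (RingProperties.-0#≈0# ring)) (+-identityʳ a)

    ≈ₚ-refl : ∀ {P} → P ≈ₚ P
    ≈ₚ-refl = 1# , unit⇒# (*-identityˡ 1#) , λ k → sym (*-identityˡ _)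

    ≈ₚ-sym : ∀ {P Q} → P ≈ₚ Q → Q ≈ₚ P
    ≈ₚ-sym (a , a#0 , eq) with invertible a#0
    ... | b , ba≈1 , ab≈1 = b , unit⇒# ab≈1 , λ k →
      sym (trans (*-congˡ (eq k))
          (trans (sym (*-assoc b a _))
          (trans (*-congʳ ba≈1) (*-identityˡ _))))

    ≈ₚ-trans : ∀ {P Q R} → P ≈ₚ Q → Q ≈ₚ R → P ≈ₚ R
    ≈ₚ-trans (a , a#0 , eq) (b , b#0 , eq′)
      with invertible a#0 | invertible b#0
    ... | a′ , a′a≈1 , _ | b′ , b′b≈1 , _ =
      a * b , unit⇒# {b = b′ * a′} inverse , λ k →
        trans (eq k) (trans (*-congˡ (eq′ k)) (sym (*-assoc a b _)))
      where
      open SetoidReasoning setoid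
      inverse : (b′ * a′) * (a * b) ≈ 1#
      inverse = begin
        (b′ * a′) * (a * b) ≈⟨ *-assoc b′ a′ (a * b) ⟩
        b′ * (a′ * (a * b)) ≈⟨ *-congˡ (sym (*-assoc a′ a b)) ⟩
        b′ * ((a′ * a) * b) ≈⟨ *-congˡ (*-congʳ a′a≈1) ⟩
        b′ * (1# * b)       ≈⟨ *-congˡ (*-identityˡ b) ⟩
        b′ * b              ≈⟨ b′b≈1 ⟩
        1#                  ∎

  pointSetoid : Setoid (c ⊔ ℓ₁) (c ⊔ ℓ₁ ⊔ ℓ₂)
  pointSetoid = record
    { Carrier       = Point
    ; _≈_           = _≈ₚ_
    ; isEquivalence = record
      { refl  = λ {P} → ≈ₚ-refl {P}
      ; sym   = λ {P} {Q} → ≈ₚ-sym {P} {Q}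
      ; trans = λ {P} {Q} {R} → ≈ₚ-trans {P} {Q} {R}
      }
    }

  HasCardinality : ∀ {p} → Pred Point p → ℕ → Set (c ⊔ ℓ₁ ⊔ ℓ₂ ⊔ p)
  HasCardinality S k =
    Bijection (≡-setoid (Fin k)) (On.setoid pointSetoid (proj₁ {B = S}))

  record Subspace : Set (lsuc (c ⊔ ℓ₁)) where
    field
      Member   : Pred 𝕍 (c ⊔ ℓ₁)
      resp     : ∀ {v w} → v ≋ w → Member v → Member w
      0-closed : Member 0ᵛ
      +-closed : ∀ {v w} → Member v → Member w → Member (v +ᵛ w)
      ·-closed : ∀ a {v} → Member v → Member (a · v)

  open Subspace public

  _∈ₚ_ : Point → Subspace → Set (c ⊔ ℓ₁)
  P ∈ₚ W = Member W (vec P)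

  _⊑_ : Subspace → Subspace → Set (c ⊔ ℓ₁)
  U ⊑ W = ∀ {v} → Member U v → Member W v

  _≐_ : Subspace → Subspace → Set (c ⊔ ℓ₁)
  U ≐ W = U ⊑ W × W ⊑ U

  infixl 7 _⊓_

  _⊓_ : Subspace → Subspace → Subspace
  U ⊓ W = record
    { Member   = λ v → Member U v × Member W v
    ; resp     = λ { eq (u , w) → resp U eq u , resp W eq w }
    ; 0-closed = 0-closed U , 0-closed W
    ; +-closed = λ { (u , w) (u′ , w′) → +-closed U u u′ , +-closed W w w′ }
    ; ·-closed = λ { a (u , w) → ·-closed U a u , ·-closed W a w }
    }

  data Generated {K : Set} (P : K → Point) : Pred 𝕍 (c ⊔ ℓ₁) where
    generator : ∀ k → Generated P (vec (P k))
    g-resp    : ∀ {v w} → v ≋ w → Generated P v → Generated P w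
    g-0       : Generated P 0ᵛ
    g-+       : ∀ {v w} → Generated P v → Generated P w → Generated P (v +ᵛ w)
    g-·       : ∀ a {v} → Generated P v → Generated P (a · v)

  ⟨_⟩ : {K : Set} → (K → Point) → Subspace
  ⟨ P ⟩ = record
    { Member   = Generated P
    ; resp     = g-resp
    ; 0-closed = g-0
    ; +-closed = g-+
    ; ·-closed = g-·
    }

  Independent : ∀ {k} → (Fin k → Point) → Set (c ⊔ ℓ₁)
  Independent {k} P = (a : Fin k → Carrier) →
    (∀ j → sum (λ i → a i * vec (P i) j) ≈ 0#) → ∀ i → a i ≈ 0#

  -- Projective dimension: one less than the size of a basis.
  HasDim : Subspace → ℕ → Set (c ⊔ ℓ₁)
  HasDim W d = ∃ λ (P : Fin (suc d) → Point) → Independent P × W ≐ ⟨ P ⟩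

  record IsSimplex (A : Fin (suc n) → Point) : Set (c ⊔ ℓ₁ ⊔ ℓ₂) where
    field
      distinct  : Injective _≡_ _≈ₚ_ A
      generates : ∀ P → P ∈ₚ ⟨ A ⟩

  -- For ∣ I ∣ ≡ suc t this is the t-space of A on I; edges are the case
  -- ∣ I ∣ ≡ 2 and faces the case ∣ I ∣ ≡ n.
  space : (Fin (suc n) → Point) → Subset (suc n) → Subspace
  space A I = ⟨ (λ ((i , _) : ∃ (_∈ I)) → A i) ⟩

  InPerspective : Point → (A B : Fin (suc n) → Point) → Set (lsuc (c ⊔ ℓ₁))
  InPerspective V A B =
    ∃ λ (L : Fin (suc n) → Subspace) →
      ∀ i → HasDim (L i) 1 × V ∈ₚ L i × A i ∈ₚ L i × B i ∈ₚ L i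

  EdgeIntersection : (A B : Fin (suc n) → Point) → Pred Point (c ⊔ ℓ₁)
  EdgeIntersection A B P =
    ∃ λ I → ∣ I ∣ ≡ 2 × P ∈ₚ space A I ⊓ space B I

{-# OPTIONS --safe #-}

-- Each line V Aᵢ Bᵢ is two-dimensional as a vector space, so V, Aᵢ, Bᵢ satisfy
-- a linear relation, with nonzero coefficients since the three points are
-- distinct.  Rescaling Aᵢ and Bᵢ turns it into bᵢ = wᵢ + V.  Write V = Σ sᵢ wᵢ;
-- if sᵢ = 0, then V lies in the face of A opposite Aᵢ and this face is common to
-- A and B, so every sᵢ is nonzero.  Let Σ zᵢ wᵢ = Σ yᵢ bᵢ be a vector of the
-- I-spaces of both A and B, where I omits some k.  Its coordinate at wₖ is
-- 0 = (Σ yᵢ) sₖ, so Σ yᵢ = 0 and the vector is Σ yᵢ wᵢ.  Hence the intersection is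
-- { Σ_{i ∈ I} yᵢ wᵢ : Σ yᵢ = 0 }, with basis wᵢ - w_{i₀} for i ∈ I ∖ {i₀}, and it
-- lies in the hyperplane v = { Σ yᵢ wᵢ : Σ yᵢ = 0 }.  For |I| = 2 it is the point
-- wᵢ - wⱼ, whose coordinates are nonzero exactly on I, so distinct edges give
-- distinct points.
module Submission where

open import Defs
open import Algebra.Apartness.Bundles using (HeytingCommutativeRing; HeytingField)
import Algebra.Apartness.Properties.HeytingCommutativeRing as HeytingProperties
open import Algebra.Bundles using (CommutativeRing)
import Algebra.Properties.Ring as RingProperties
import Algebra.Properties.Semiring.Sum as Sum
open import Data.Fin.Base using (Fin; zero; suc; punchIn)
open import Data.Fin.Properties using (+↔⊎; any?)
open import Data.Fin.Subset
  using (Subset; inside; outside; ∣_∣; _∈_; _∉_; _⊆_; ⊥; ⁅_⁆; ∁)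
open import Data.Fin.Subset.Properties
  using (_∈?_; x∉p⇒x∈∁p; x∈∁p⇒x∉p; x∈⁅x⁆; x∈⁅y⁆⇒x≡y; ⊆-antisym; ∣⊥∣≡0; ∣∁p∣≡n∸∣p∣; ∣⁅x⁆∣≡1)
open import Data.Nat.Base using (ℕ; zero; suc; _≤_; _<_; _∸_; s≤s; z≤n; s<s⁻¹)
open import Data.Nat.Combinatorics using (_C_; nCk+nC[k+1]≡[n+1]C[k+1])
open import Data.Nat.Properties using (suc-injective; ≡-irrelevant; n<1+n)
open import Data.Product using (∃; ∃!; _×_; _,_; proj₁; proj₂)
open import Data.Sum.Base using (_⊎_; inj₁; inj₂)
open import Data.Sum.Function.Propositional using (_⊎-↔_)
open import Data.Vec.Base using (here; there) renaming ([] to []ᵥ; _∷_ to _∷ᵥ_)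
open import Data.Vec.Functional using (Vector; []; _∷_; insertAt; removeAt)
open import Data.Vec.Functional.Properties using (insertAt-lookup; insertAt-punchIn)
open import Function.Base using (_∘_)
open import Function.Bundles using (_↔_; mk↔ₛ′; Injection; Inverse)
open import Function.Properties.Inverse using (↔-trans; ↔⇒↣)
open import Level using (_⊔_)
open import Relation.Binary.Bundles using (Setoid)
open import Relation.Binary.Definitions using (Decidable)
open import Relation.Binary.PropositionalEquality using (_≡_; _≢_; refl; cong)
  renaming (sym to ≡-sym; trans to ≡-trans; subst to ≡-subst)
import Relation.Binary.Reasoning.Setoid as SetoidReasoning
open import Relation.Nullary using (¬_; yes; no)
open import Relation.Nullary.Decidable using (decidable-stable)
open import Relation.Nullary.Negation using (contradiction)

-- Subsets of a given size and their enumeration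

SubsetOfSize : ℕ → ℕ → Set
SubsetOfSize m k = ∃ λ (I : Subset m) → ∣ I ∣ ≡ k

SubsetOfSize-≡ : ∀ {m k} {X Y : SubsetOfSize m k} → proj₁ X ≡ proj₁ Y → X ≡ Y
SubsetOfSize-≡ {X = I , p} {.I , q} refl = cong (I ,_) (≡-irrelevant p q)

∣p∣≡0⇒p≡⊥ : ∀ {m} {p : Subset m} → ∣ p ∣ ≡ 0 → p ≡ ⊥
∣p∣≡0⇒p≡⊥ {p = []ᵥ}          _  = refl
∣p∣≡0⇒p≡⊥ {p = outside ∷ᵥ p} eq = cong (outside ∷ᵥ_) (∣p∣≡0⇒p≡⊥ eq)

-- Pascal's rule as a bijection: a subset either contains the first element or avoids it.
subsets-pascal : ∀ {m k} →
  (SubsetOfSize m k ⊎ SubsetOfSize m (suc k)) ↔ SubsetOfSize (suc m) (suc k)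
subsets-pascal {m} {k} = mk↔ₛ′ to from
  (λ { (inside ∷ᵥ I , eq) → SubsetOfSize-≡ refl ; (outside ∷ᵥ I , eq) → refl })
  (λ { (inj₁ X) → cong inj₁ (SubsetOfSize-≡ refl) ; (inj₂ X) → refl })
  where
  to : SubsetOfSize m k ⊎ SubsetOfSize m (suc k) → SubsetOfSize (suc m) (suc k)
  to (inj₁ (I , eq)) = inside ∷ᵥ I , cong suc eq
  to (inj₂ (I , eq)) = outside ∷ᵥ I , eq
  from : SubsetOfSize (suc m) (suc k) → SubsetOfSize m k ⊎ SubsetOfSize m (suc k)
  from (inside  ∷ᵥ I , eq) = inj₁ (I , suc-injective eq)
  from (outside ∷ᵥ I , eq) = inj₂ (I , eq)

-- Follows Pascal's recursion for `_C_`. A bijection rather than a count is built because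
-- `HasCardinality` asks for one.
enumerate : ∀ m k → Fin (m C k) ↔ SubsetOfSize m k
enumerate m zero = mk↔ₛ′ (λ _ → ⊥ , ∣⊥∣≡0 m) (λ _ → zero)
  (λ (I , eq) → SubsetOfSize-≡ (≡-sym (∣p∣≡0⇒p≡⊥ eq))) (λ { zero → refl })
enumerate zero    (suc k) = mk↔ₛ′ (λ ()) (λ { ([]ᵥ , ()) }) (λ { ([]ᵥ , ()) }) (λ ())
enumerate (suc m) (suc k) = ≡-subst (λ N → Fin N ↔ SubsetOfSize (suc m) (suc k))
  (nCk+nC[k+1]≡[n+1]C[k+1] m k)
  (↔-trans +↔⊎ (↔-trans (enumerate m k ⊎-↔ enumerate m (suc k)) subsets-pascal))

-- Supplies the index outside `I` at which two expansions of the same vector are compared.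
missing-element : ∀ {m} (I : Subset m) → ∣ I ∣ < m → ∃ (_∉ I)
missing-element (outside ∷ᵥ I) _     = zero , λ ()
missing-element (inside  ∷ᵥ I) ∣I∣<m with missing-element I (s<s⁻¹ ∣I∣<m)
... | i , i∉I = suc i , λ { (there i∈I) → i∉I i∈I }

∣∁⁅x⁆∣≡n : ∀ {n} (i : Fin (suc n)) → ∣ ∁ ⁅ i ⁆ ∣ ≡ n
∣∁⁅x⁆∣≡n {n} i = ≡-trans (∣∁p∣≡n∸∣p∣ ⁅ i ⁆) (cong (suc n ∸_) (∣⁅x⁆∣≡1 i))

-- The increasing enumeration of `I`; it turns vectors indexed by `I` into a family over
-- `Fin ∣ I ∣`, to which sums apply.
members : ∀ {m} (I : Subset m) → Fin ∣ I ∣ → Fin m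
members (inside  ∷ᵥ I) zero    = zero
members (inside  ∷ᵥ I) (suc k) = suc (members I k)
members (outside ∷ᵥ I) k       = suc (members I k)

members-∈ : ∀ {m} (I : Subset m) k → members I k ∈ I
members-∈ (inside  ∷ᵥ I) zero    = here
members-∈ (inside  ∷ᵥ I) (suc k) = there (members-∈ I k)
members-∈ (outside ∷ᵥ I) k       = there (members-∈ I k)

∈-members : ∀ {m} {I : Subset m} {i} → i ∈ I → ∃ λ k → members I k ≡ i
∈-members                   here        = zero , refl
∈-members {I = inside  ∷ᵥ I} (there i∈I) with ∈-members i∈I
... | k , refl = suc k , refl
∈-members {I = outside ∷ᵥ I} (there i∈I) with ∈-members i∈I
... | k , refl = k , refl

-- Scalars and finite sums over a field with decidable apartness

module LinearAlgebra {c ℓ₁ ℓ₂} (F : HeytingField c ℓ₁ ℓ₂)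
  (_#?_ : Decidable (HeytingField._#_ F)) where

  open HeytingField F hiding (refl; zero)
  open HeytingField F using () renaming (refl to ≈-refl)
  open HeytingCommutativeRing heytingCommutativeRing using (commutativeRing)
  open CommutativeRing commutativeRing using (ring; semiring)
  open RingProperties ring
  open HeytingProperties heytingCommutativeRing
  open Sum semiring
  open SetoidReasoning setoid

  -- Tightness turns a refuted apartness into an equality, so decidable apartness makes the field
  -- discrete.
  ≈0⊎#0 : ∀ a → a ≈ 0# ⊎ a # 0#
  ≈0⊎#0 a with a #? 0#
  ... | yes a#0 = inj₂ a#0
  ... | no ¬a#0 = inj₁ (proj₁ (tight a 0#) ¬a#0)

  #⇒≉ : ∀ {a b} → a # b → ¬ (a ≈ b)
  #⇒≉ a#b a≈b = #-irrefl a≈b a#b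

  inverse : ∀ {a} → a # 0# → ∃ λ a⁻¹ → a⁻¹ * a ≈ 1#
  inverse {a} a#0 with #⇒invertible a#0
  ... | a⁻¹ , a⁻¹a≈1 , _ = a⁻¹ , trans (*-congˡ (sym (x-0≈x a))) a⁻¹a≈1

  ≉0⇒#0 : ∀ {a} → ¬ (a ≈ 0#) → a # 0#
  ≉0⇒#0 {a} a≉0 with ≈0⊎#0 a
  ... | inj₁ a≈0 = contradiction a≈0 a≉0
  ... | inj₂ a#0 = a#0

  *-cancel-#0 : ∀ {a b} → a # 0# → a * b ≈ 0# → b ≈ 0#
  *-cancel-#0 {a} {b} a#0 ab≈0 with inverse a#0
  ... | a⁻¹ , a⁻¹a≈1 = begin
    b              ≈⟨ *-identityˡ b ⟨
    1# * b         ≈⟨ *-congʳ a⁻¹a≈1 ⟨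
    a⁻¹ * a * b    ≈⟨ *-assoc a⁻¹ a b ⟩
    a⁻¹ * (a * b)  ≈⟨ *-congˡ ab≈0 ⟩
    a⁻¹ * 0#       ≈⟨ zeroʳ a⁻¹ ⟩
    0#             ∎

  -x≈0⇒x≈0 : ∀ {x} → - x ≈ 0# → x ≈ 0#
  -x≈0⇒x≈0 {x} -x≈0 = trans (sym (-‿involutive x)) (trans (-‿cong -x≈0) -0#≈0#)

  sum-zero : ∀ {m} (f : Vector Carrier m) → (∀ i → f i ≈ 0#) → sum f ≈ 0#
  sum-zero {m} f f≈0 = trans (sum-cong-≋ f≈0) (sum-replicate-zero m)

  sum-neg : ∀ {m} (f : Vector Carrier m) → sum (λ i → - f i) ≈ - sum f
  sum-neg f = begin
    sum (λ i → - f i)      ≈⟨ sum-cong-≋ (λ i → sym (-1*x≈-x (f i))) ⟩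
    sum (λ i → - 1# * f i) ≈⟨ *-distribˡ-sum (- 1#) f ⟨
    - 1# * sum f           ≈⟨ -1*x≈-x (sum f) ⟩
    - sum f                ∎

  -- Two entries of sum zero are opposite. The length is a variable `k` because the lemma is applied
  -- with `k` equal to `∣ I ∣`.
  sum-pair≈0 : ∀ {k} → k ≡ 2 → (z : Vector Carrier k) → sum z ≈ 0# →
    ∀ {i} → z i ≈ 0# → ∀ l → z l ≈ 0#
  sum-pair≈0 refl z Σz≈0 {zero}     z₀≈0 zero       = z₀≈0
  sum-pair≈0 refl z Σz≈0 {zero}     z₀≈0 (suc zero) = begin
    z (suc zero)                   ≈⟨ +-identityʳ _ ⟨
    z (suc zero) + 0#              ≈⟨ +-identityˡ _ ⟨
    0# + (z (suc zero) + 0#)       ≈⟨ +-congʳ z₀≈0 ⟨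
    z zero + (z (suc zero) + 0#)   ≈⟨ Σz≈0 ⟩
    0#                             ∎
  sum-pair≈0 refl z Σz≈0 {suc zero} z₁≈0 zero       = begin
    z zero                         ≈⟨ +-identityʳ _ ⟨
    z zero + 0#                    ≈⟨ +-congˡ (+-identityʳ _) ⟨
    z zero + (0# + 0#)             ≈⟨ +-congˡ (+-congʳ z₁≈0) ⟨
    z zero + (z (suc zero) + 0#)   ≈⟨ Σz≈0 ⟩
    0#                             ∎
  sum-pair≈0 refl z Σz≈0 {suc zero} z₁≈0 (suc zero) = z₁≈0

  -- The Kronecker delta. Recursion on the index, instead of an equality test, lets the sums in
  -- `sum-δ-*` compute.
  δ : ∀ {m} → Fin m → Vector Carrier m
  δ zero    = 1# ∷ (λ _ → 0#)
  δ (suc i) = 0# ∷ δ i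

  δ-sym : ∀ {m} (i j : Fin m) → δ i j ≡ δ j i
  δ-sym zero    zero    = refl
  δ-sym zero    (suc j) = refl
  δ-sym (suc i) zero    = refl
  δ-sym (suc i) (suc j) = δ-sym i j

  δ-diagonal : ∀ {m} (i : Fin m) → δ i i ≡ 1#
  δ-diagonal zero    = refl
  δ-diagonal (suc i) = δ-diagonal i

  δ-off-diagonal : ∀ {m} {i j : Fin m} → i ≢ j → δ i j ≡ 0#
  δ-off-diagonal {i = zero}  {zero}  i≢j = contradiction refl i≢j
  δ-off-diagonal {i = zero}  {suc j} i≢j = refl
  δ-off-diagonal {i = suc i} {zero}  i≢j = refl
  δ-off-diagonal {i = suc i} {suc j} i≢j = δ-off-diagonal (i≢j ∘ cong suc)

  sum-δ-* : ∀ {m} (i : Fin m) (f : Vector Carrier m) → sum (λ j → δ i j * f j) ≈ f i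
  sum-δ-* zero f = begin
    1# * f zero + sum (λ j → 0# * f (suc j))
      ≈⟨ +-cong (*-identityˡ _) (sum-zero (λ j → 0# * f (suc j)) λ j → zeroˡ _) ⟩
    f zero + 0#
      ≈⟨ +-identityʳ _ ⟩
    f zero ∎
  sum-δ-* (suc i) f = begin
    0# * f zero + sum (λ j → δ i j * f (suc j))
      ≈⟨ +-cong (zeroˡ _) (sum-δ-* i (λ j → f (suc j))) ⟩
    0# + f (suc i)
      ≈⟨ +-identityˡ _ ⟩
    f (suc i) ∎

  -- Linear combinations and Gaussian elimination

  opaque

    -- Opaque, so that unification recovers a, w and j from lin a w j.
    lin : ∀ {k m} → Vector Carrier k → (Fin k → Vector Carrier m) → Vector Carrier m
    lin a w j = sum (λ i → a i * w i j)

    lin-def : ∀ {k m} (a : Vector Carrier k) (w : Fin k → Vector Carrier m) j →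
      lin a w j ≡ sum (λ i → a i * w i j)
    lin-def a w j = refl

  module _ {k m} (w : Fin k → Vector Carrier m) where
    opaque
      unfolding lin

      lin-congˡ : ∀ {a b} → (∀ i → a i ≈ b i) → ∀ j → lin a w j ≈ lin b w j
      lin-congˡ a≈b j = sum-cong-≋ λ i → *-congʳ (a≈b i)

      lin-congʳ : ∀ a {w′} → (∀ i j → w i j ≈ w′ i j) → ∀ j → lin a w j ≈ lin a w′ j
      lin-congʳ a w≈w′ j = sum-cong-≋ λ i → *-congˡ {a i} (w≈w′ i j)

      lin-zeroˡ : ∀ {a} → (∀ i → a i ≈ 0#) → ∀ j → lin a w j ≈ 0#
      lin-zeroˡ a≈0 j = sum-zero _ λ i → trans (*-congʳ (a≈0 i)) (zeroˡ (w i j))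

      lin-zeroʳ : ∀ a j → (∀ i → w i j ≈ 0#) → lin a w j ≈ 0#
      lin-zeroʳ a j w≈0 = sum-zero _ λ i → trans (*-congˡ {a i} (w≈0 i)) (zeroʳ (a i))

      lin-+ˡ : ∀ a b j → lin (λ i → a i + b i) w j ≈ lin a w j + lin b w j
      lin-+ˡ a b j = trans (sum-cong-≋ λ i → distribʳ (w i j) (a i) (b i))
                           (∑-distrib-+ (λ i → a i * w i j) (λ i → b i * w i j))

      lin-*ˡ : ∀ x a j → lin (λ i → x * a i) w j ≈ x * lin a w j
      lin-*ˡ x a j = trans (sum-cong-≋ λ i → *-assoc x (a i) (w i j))
                           (sym (*-distribˡ-sum x (λ i → a i * w i j)))

      lin-negˡ : ∀ a j → lin (λ i → - a i) w j ≈ - lin a w j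
      lin-negˡ a j = trans (sum-cong-≋ λ i → sym (-‿distribˡ-* (a i) (w i j)))
                           (sum-neg λ i → a i * w i j)

      lin-neg : ∀ a j → lin (λ i → - a i) w j ≈ lin a (λ i j → - w i j) j
      lin-neg a j = sum-cong-≋ λ i →
        trans (sym (-‿distribˡ-* (a i) (w i j))) (-‿distribʳ-* (a i) (w i j))

      -- Serves twice: with `g` clearing a column it is the elimination step of `dependency`, and
      -- with `g` constantly 1 it is translation by `v`.
      lin-shear : ∀ a (g : Vector Carrier k) (v : Vector Carrier m) j →
        lin a (λ i j → w i j + g i * v j) j ≈ lin a w j + sum (λ i → a i * g i) * v j
      lin-shear a g v j = begin
        sum (λ i → a i * (w i j + g i * v j))
          ≈⟨ sum-cong-≋ (λ i → distribˡ (a i) (w i j) (g i * v j)) ⟩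
        sum (λ i → a i * w i j + a i * (g i * v j))
          ≈⟨ ∑-distrib-+ (λ i → a i * w i j) (λ i → a i * (g i * v j)) ⟩
        lin a w j + sum (λ i → a i * (g i * v j))
          ≈⟨ +-congˡ (sum-cong-≋ λ i → *-assoc (a i) (g i) (v j)) ⟨
        lin a w j + sum (λ i → a i * g i * v j)
          ≈⟨ +-congˡ (*-distribʳ-sum (v j) (λ i → a i * g i)) ⟨
        lin a w j + sum (λ i → a i * g i) * v j ∎

      lin-translate : ∀ a (v : Vector Carrier m) j →
        lin a (λ i j → w i j + v j) j ≈ lin a w j + sum a * v j
      lin-translate a v j = begin
        lin a (λ i j → w i j + v j) j
          ≈⟨ sum-cong-≋ (λ i → *-congˡ {a i} (+-congˡ {w i j} (*-identityˡ (v j)))) ⟨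
        lin a (λ i j → w i j + 1# * v j) j
          ≈⟨ lin-shear a (λ _ → 1#) v j ⟩
        lin a w j + sum (λ i → a i * 1#) * v j
          ≈⟨ +-congˡ (*-congʳ (sum-cong-≋ λ i → *-identityʳ (a i))) ⟩
        lin a w j + sum a * v j ∎

      lin-δ : ∀ i j → lin (δ i) w j ≈ w i j
      lin-δ i j = sum-δ-* i (λ k → w k j)

      -- Associativity of the matrix product, by exchanging the two sums.
      lin-lin : ∀ {l} (a : Vector Carrier l) N j → lin a (λ i → lin (N i) w) j ≈ lin (lin a N) w j
      lin-lin a N j = begin
        sum (λ i → a i * sum (λ k → N i k * w k j))
          ≈⟨ sum-cong-≋ (λ i → *-distribˡ-sum (a i) (λ k → N i k * w k j)) ⟩
        sum (λ i → sum (λ k → a i * (N i k * w k j)))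
          ≈⟨ sum-cong-≋ (λ i → sum-cong-≋ λ k → sym (*-assoc (a i) (N i k) (w k j))) ⟩
        sum (λ i → sum (λ k → a i * N i k * w k j))
          ≈⟨ ∑-comm (λ i k → a i * N i k * w k j) ⟩
        sum (λ k → sum (λ i → a i * N i k * w k j))
          ≈⟨ sum-cong-≋ (λ k → *-distribʳ-sum (w k j) (λ i → a i * N i k)) ⟨
        sum (λ k → sum (λ i → a i * N i k) * w k j) ∎

  opaque
    unfolding lin

    lin-suc : ∀ {k m} a (w : Fin (suc k) → Vector Carrier m) j →
      lin a w j ≈ a zero * w zero j + lin (λ i → a (suc i)) (λ i → w (suc i)) j
    lin-suc a w j = ≈-refl

    lin-tail : ∀ {k m} a (w : Fin k → Vector Carrier (suc m)) j →
      lin a (λ i j → w i (suc j)) j ≈ lin a w (suc j)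
    lin-tail a w j = ≈-refl

    lin-insertAt : ∀ {k m} a p x (w : Fin (suc k) → Vector Carrier m) j →
      lin (insertAt a p x) w j ≈ x * w p j + lin a (λ i → w (punchIn p i)) j
    lin-insertAt a p x w j = begin
      lin (insertAt a p x) w j
        ≈⟨ sum-remove {i = p} (λ i → insertAt a p x i * w i j) ⟩
      insertAt a p x p * w p j + lin (removeAt (insertAt a p x) p) (λ i → w (punchIn p i)) j
        ≈⟨ +-cong (*-congʳ (reflexive (insertAt-lookup a p x)))
                  (lin-congˡ (λ i → w (punchIn p i)) (λ i → reflexive (insertAt-punchIn a p x i)) j) ⟩
      x * w p j + lin a (λ i → w (punchIn p i)) j ∎

    lin-basis : ∀ {m} (a : Vector Carrier m) j → lin a δ j ≈ a j
    lin-basis a j = begin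
      sum (λ i → a i * δ i j)  ≈⟨ sum-cong-≋ (λ i → *-comm (a i) (δ i j)) ⟩
      sum (λ i → δ i j * a i)  ≈⟨ sum-cong-≋ (λ i → *-congʳ (reflexive (δ-sym i j))) ⟩
      sum (λ i → δ j i * a i)  ≈⟨ sum-δ-* j a ⟩
      a j                      ∎

  lin-three : ∀ {m} a (u v w : Vector Carrier m) j →
    lin a (u ∷ v ∷ w ∷ []) j ≈ a zero * u j + (a (suc zero) * v j + a (suc (suc zero)) * w j)
  lin-three a u v w j = begin
    lin a (u ∷ v ∷ w ∷ []) j
      ≈⟨ lin-suc a _ j ⟩
    a zero * u j + lin _ (v ∷ w ∷ []) j
      ≈⟨ +-congˡ (lin-suc _ _ j) ⟩
    a zero * u j + (a (suc zero) * v j + lin _ (w ∷ []) j)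
      ≈⟨ +-congˡ (+-congˡ (lin-suc _ _ j)) ⟩
    a zero * u j + (a (suc zero) * v j
      + (a (suc (suc zero)) * w j + lin (λ i → a (suc (suc (suc i)))) [] j))
      ≈⟨ +-congˡ (+-congˡ (+-congˡ (lin-zeroˡ [] (λ ()) j))) ⟩
    a zero * u j + (a (suc zero) * v j + (a (suc (suc zero)) * w j + 0#))
      ≈⟨ +-congˡ (+-congˡ (+-identityʳ _)) ⟩
    a zero * u j + (a (suc zero) * v j + a (suc (suc zero)) * w j) ∎

  -- Translation adds `sum x` copies of `v`, each with coordinates `s`. With the vertex for `v`,
  -- this converts coordinates over the vectors of B into coordinates over those of A.
  lin-translate-span : ∀ {k m} {w : Fin k → Vector Carrier m} {v s} → (∀ j → v j ≈ lin s w j) →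
    ∀ x j → lin x (λ i j → w i j + v j) j ≈ lin (λ i → x i + sum x * s i) w j
  lin-translate-span {w = w} {v} {s} v≈sw x j = begin
    lin x (λ i j → w i j + v j) j                ≈⟨ lin-translate w x v j ⟩
    lin x w j + sum x * v j                      ≈⟨ +-congˡ (*-congˡ (v≈sw j)) ⟩
    lin x w j + sum x * lin s w j                ≈⟨ +-congˡ (lin-*ˡ w (sum x) s j) ⟨
    lin x w j + lin (λ i → sum x * s i) w j      ≈⟨ lin-+ˡ w x (λ i → sum x * s i) j ⟨
    lin (λ i → x i + sum x * s i) w j            ∎

  -- The translations cancel. This is why zero-sum combinations of the vectors of A lie in the
  -- spaces of B as well.
  lin-translate-zeroSum : ∀ {k m} (w : Fin k → Vector Carrier m) {x} → sum x ≈ 0# →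
    ∀ v j → lin x (λ i j → w i j + v j) j ≈ lin x w j
  lin-translate-zeroSum w {x} Σx≈0 v j = begin
    lin x (λ i j → w i j + v j) j  ≈⟨ lin-translate w x v j ⟩
    lin x w j + sum x * v j        ≈⟨ +-congˡ (trans (*-congʳ Σx≈0) (zeroˡ _)) ⟩
    lin x w j + 0#                 ≈⟨ +-identityʳ _ ⟩
    lin x w j                      ∎

  -- Gaussian elimination on the first coordinate, by induction on `m`. If that coordinate vanishes
  -- throughout, it is dropped together with one vector, whose coefficient is set to 0. Otherwise a
  -- pivot vector clears it from the others, and a relation among these is extended to the pivot.
  dependency : ∀ {m} (w : Fin (suc m) → Vector Carrier m) →
    ∃ λ a → (∀ j → lin a w j ≈ 0#) × ∃ λ i → a i # 0#
  dependency {zero}  w = (λ _ → 1#) , (λ ()) , zero , 1#0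
  dependency {suc m} w with any? (λ i → w i zero #? 0#)
  ... | no ¬pivot with dependency (λ i j → w (suc i) (suc j))
  ...   | a , aw≈0 , i , ai#0 = (0# ∷ a) , vanish , suc i , ai#0
    where
    vanish : ∀ j → lin (0# ∷ a) w j ≈ 0#
    vanish zero    = lin-zeroʳ w _ zero λ i → proj₁ (tight _ 0#) λ wi0#0 → ¬pivot (i , wi0#0)
    vanish (suc j) = begin
      lin (0# ∷ a) w (suc j)
        ≈⟨ lin-suc (0# ∷ a) w (suc j) ⟩
      0# * w zero (suc j) + lin a (λ i → w (suc i)) (suc j)
        ≈⟨ +-cong (zeroˡ _) (trans (sym (lin-tail a (λ i → w (suc i)) j)) (aw≈0 j)) ⟩
      0# + 0#
        ≈⟨ +-identityˡ 0# ⟩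
      0# ∎
  dependency {suc m} w | yes (p , pivot) with inverse pivot
  ... | q , q*pivot≈1 = eliminate (dependency (λ i j → cleared i (suc j)))
    where
    g : Fin (suc m) → Carrier
    g i = - (w (punchIn p i) zero * q)
    cleared : Fin (suc m) → Vector Carrier (suc m)
    cleared i j = w (punchIn p i) j + g i * w p j
    cleared-zero : ∀ i → cleared i zero ≈ 0#
    cleared-zero i = begin
      x + - (x * q) * w p zero    ≈⟨ +-congˡ (-‿distribˡ-* (x * q) (w p zero)) ⟨
      x - x * q * w p zero        ≈⟨ +-congˡ (-‿cong (*-assoc x q (w p zero))) ⟩
      x - x * (q * w p zero)      ≈⟨ +-congˡ (-‿cong (*-congˡ q*pivot≈1)) ⟩
      x - x * 1#                  ≈⟨ +-congˡ (-‿cong (*-identityʳ x)) ⟩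
      x - x                       ≈⟨ -‿inverseʳ x ⟩
      0#                          ∎
      where x = w (punchIn p i) zero
    eliminate : (∃ λ a → (∀ j → lin a (λ i j → cleared i (suc j)) j ≈ 0#) × ∃ λ i → a i # 0#) →
                ∃ λ a → (∀ j → lin a w j ≈ 0#) × ∃ λ i → a i # 0#
    eliminate (a , aw≈0 , i , ai#0) =
      insertAt a p μ , vanish , punchIn p i ,
      ≡-subst (_# 0#) (≡-sym (insertAt-punchIn a p μ i)) ai#0
      where
      -- The multiples of `w p` introduced by the clearing, collected into the coefficient of the
      -- pivot vector.
      μ : Carrier
      μ = sum (λ i → a i * g i)
      cleared-vanish : ∀ j → lin a cleared j ≈ 0#
      cleared-vanish zero    = lin-zeroʳ cleared a zero cleared-zero
      cleared-vanish (suc j) = trans (sym (lin-tail a cleared j)) (aw≈0 j)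
      vanish : ∀ j → lin (insertAt a p μ) w j ≈ 0#
      vanish j = begin
        lin (insertAt a p μ) w j
          ≈⟨ lin-insertAt a p μ w j ⟩
        μ * w p j + lin a (λ i → w (punchIn p i)) j
          ≈⟨ +-comm _ _ ⟩
        lin a (λ i → w (punchIn p i)) j + μ * w p j
          ≈⟨ lin-shear (λ i → w (punchIn p i)) a g (w p) j ⟨
        lin a cleared j
          ≈⟨ cleared-vanish j ⟩
        0# ∎

  -- Linear independence

  Ind : ∀ {k m} → (Fin k → Vector Carrier m) → Set _
  Ind {k} w = (a : Vector Carrier k) → (∀ j → lin a w j ≈ 0#) → ∀ i → a i ≈ 0#

  Ind⇒unique : ∀ {k m} {w : Fin k → Vector Carrier m} → Ind w → ∀ {a b} →
    (∀ j → lin a w j ≈ lin b w j) → ∀ i → a i ≈ b i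
  Ind⇒unique {w = w} ind {a} {b} eq i = x∙y⁻¹≈ε⇒x≈y _ _ (ind (λ i → a i - b i) vanish i)
    where
    vanish : ∀ j → lin (λ i → a i - b i) w j ≈ 0#
    vanish j = begin
      lin (λ i → a i - b i) w j             ≈⟨ lin-+ˡ w a (λ i → - b i) j ⟩
      lin a w j + lin (λ i → - b i) w j     ≈⟨ +-cong (eq j) (lin-negˡ w b j) ⟩
      lin b w j - lin b w j                 ≈⟨ -‿inverseʳ _ ⟩
      0#                                    ∎

  Ind⇒nonzero : ∀ {k m} {w : Fin k → Vector Carrier m} → Ind w →
    ∀ i → ¬ (∀ j → w i j ≈ 0#)
  Ind⇒nonzero {w = w} ind i wi≈0 = #⇒≉ 1#0
    (trans (reflexive (≡-sym (δ-diagonal i))) (ind (δ i) (λ j → trans (lin-δ w i j) (wi≈0 j)) i))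

  -- The m + 1 vectors a, N₀, N₁, … of F^m are dependent, and applying
  -- x ↦ lin x w to the dependency leaves only a multiple of a.
  spanning⇒Ind : ∀ {m} (w : Fin m → Vector Carrier m) →
    (∀ i → ∃ λ x → ∀ j → δ i j ≈ lin x w j) → Ind w
  spanning⇒Ind {m} w spans a aw≈0 with dependency (a ∷ λ i → proj₁ (spans i))
  ... | b , bN≈0 , l , bl#0 = λ j → *-cancel-#0 (b₀#0 l bl#0) (begin
      b zero * a j               ≈⟨ +-identityʳ _ ⟨
      b zero * a j + 0#          ≈⟨ +-congˡ (lin-zeroˡ N b₊≈0 j) ⟨
      b zero * a j + lin b₊ N j  ≈⟨ lin-suc b (a ∷ N) j ⟨
      lin b (a ∷ N) j            ≈⟨ bN≈0 j ⟩
      0#                         ∎)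
    where
    N : Fin m → Vector Carrier m
    N i = proj₁ (spans i)
    b₊ : Vector Carrier m
    b₊ i = b (suc i)
    b₊≈0 : ∀ i → b₊ i ≈ 0#
    b₊≈0 j = begin
      b₊ j                                        ≈⟨ lin-basis b₊ j ⟨
      lin b₊ δ j                                  ≈⟨ lin-congʳ δ b₊ (λ i → proj₂ (spans i)) j ⟩
      lin b₊ (λ i → lin (N i) w) j                ≈⟨ +-identityˡ _ ⟨
      0# + lin b₊ (λ i → lin (N i) w) j           ≈⟨ +-congʳ (zeroʳ (b zero)) ⟨
      b zero * 0# + lin b₊ (λ i → lin (N i) w) j  ≈⟨ +-congʳ (*-congˡ (aw≈0 j)) ⟨
      b zero * lin a w j + lin b₊ (λ i → lin (N i) w) j
        ≈⟨ lin-suc b (λ i → lin ((a ∷ N) i) w) j ⟨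
      lin b (λ i → lin ((a ∷ N) i) w) j           ≈⟨ lin-lin w b (a ∷ N) j ⟩
      lin (lin b (a ∷ N)) w j                     ≈⟨ lin-zeroˡ w bN≈0 j ⟩
      0#                                          ∎
    b₀#0 : ∀ l → b l # 0# → b zero # 0#
    b₀#0 zero    b₀#0 = b₀#0
    b₀#0 (suc i) bᵢ#0 = contradiction (b₊≈0 i) (#⇒≉ bᵢ#0)

  -- Extension by zero from a subset of the indices

  extend : ∀ {m} (I : Subset m) → Vector Carrier ∣ I ∣ → Vector Carrier m
  extend []ᵥ            z = []
  extend (inside  ∷ᵥ I) z = z zero ∷ extend I (z ∘ suc)
  extend (outside ∷ᵥ I) z = 0# ∷ extend I z

  extend-members : ∀ {m} (I : Subset m) z k → extend I z (members I k) ≡ z k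
  extend-members (inside  ∷ᵥ I) z zero    = refl
  extend-members (inside  ∷ᵥ I) z (suc k) = extend-members I (z ∘ suc) k
  extend-members (outside ∷ᵥ I) z k       = extend-members I z k

  extend-∈ : ∀ {m} (I : Subset m) z {i} → i ∈ I → ∃ λ k → z k ≡ extend I z i
  extend-∈ I z i∈I with ∈-members i∈I
  ... | k , refl = k , ≡-sym (extend-members I z k)

  extend-∉ : ∀ {m} (I : Subset m) z {i} → i ∉ I → extend I z i ≡ 0#
  extend-∉ (inside  ∷ᵥ I) z {zero}  i∉I = contradiction here i∉I
  extend-∉ (inside  ∷ᵥ I) z {suc i} i∉I = extend-∉ I (z ∘ suc) (i∉I ∘ there)
  extend-∉ (outside ∷ᵥ I) z {zero}  i∉I = refl
  extend-∉ (outside ∷ᵥ I) z {suc i} i∉I = extend-∉ I z (i∉I ∘ there)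

  -- Indices outside `I` contribute `φ i 0#`, hence nothing. The identity for `φ` gives
  -- `sum-extend`, multiplication by `w i j` gives `lin-extend`.
  sum-map-extend : ∀ {m} (I : Subset m) z (φ : Fin m → Carrier → Carrier) → (∀ i → φ i 0# ≈ 0#) →
    sum (λ i → φ i (extend I z i)) ≈ sum (λ k → φ (members I k) (z k))
  sum-map-extend []ᵥ            z φ φ0≈0 = ≈-refl
  sum-map-extend (inside  ∷ᵥ I) z φ φ0≈0 =
    +-congˡ (sum-map-extend I (z ∘ suc) (φ ∘ suc) (φ0≈0 ∘ suc))
  sum-map-extend (outside ∷ᵥ I) z φ φ0≈0 =
    trans (+-cong (φ0≈0 zero) (sum-map-extend I z (φ ∘ suc) (φ0≈0 ∘ suc))) (+-identityˡ _)

  sum-extend : ∀ {m} (I : Subset m) z → sum (extend I z) ≈ sum z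
  sum-extend I z = sum-map-extend I z (λ _ x → x) (λ _ → ≈-refl)

  opaque
    unfolding lin

    lin-extend : ∀ {k m} (I : Subset k) z (w : Fin k → Vector Carrier m) j →
      lin (extend I z) w j ≈ lin z (w ∘ members I) j
    lin-extend I z w j = sum-map-extend I z (λ i x → x * w i j) (λ i → zeroˡ (w i j))

  -- A relation on the subfamily extends by zero to one on the whole family.
  Ind-members : ∀ {k m} {w : Fin k → Vector Carrier m} → Ind w → ∀ I → Ind (w ∘ members I)
  Ind-members {w = w} ind I z zw≈0 k = trans (reflexive (≡-sym (extend-members I z k)))
    (ind (extend I z) (λ j → trans (lin-extend I z w j) (zw≈0 j)) (members I k))

-- Subspaces, their coordinates and dimensions

module Geometry {c ℓ₁ ℓ₂} (F : HeytingField c ℓ₁ ℓ₂)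
  (_#?_ : Decidable (HeytingField._#_ F)) (n : ℕ) where

  open HeytingField F hiding (refl; zero)
  open HeytingField F using () renaming (refl to ≈-refl)
  open HeytingCommutativeRing heytingCommutativeRing using (commutativeRing)
  open CommutativeRing commutativeRing using (ring; semiring)
  open RingProperties ring
  open HeytingProperties heytingCommutativeRing
  open Sum semiring
  open SetoidReasoning setoid
  open LinearAlgebra F _#?_
  open ProjectiveSpace F n

  lin-member : ∀ {k} (W : Subspace) (x : Vector Carrier k) (w : Fin k → 𝕍) →
    (∀ i → Member W (x i · w i)) → Member W (lin x w)
  lin-member {zero}  W x w xw∈W = resp W (λ j → sym (lin-zeroˡ w (λ ()) j)) (0-closed W)
  lin-member {suc k} W x w xw∈W = resp W (λ j → sym (lin-suc x w j))
    (+-closed W (xw∈W zero) (lin-member W (x ∘ suc) (w ∘ suc) (xw∈W ∘ suc)))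

  -- A vector with coefficient zero may lie outside `W`; this lets a combination pass into a face
  -- when its coefficient at the opposite vertex vanishes.
  lin-member′ : ∀ {k} (W : Subspace) (x : Vector Carrier k) (w : Fin k → 𝕍) →
    (∀ i → x i # 0# → Member W (w i)) → Member W (lin x w)
  lin-member′ W x w w∈W = lin-member W x w λ i → go i (≈0⊎#0 (x i))
    where
    go : ∀ i → x i ≈ 0# ⊎ x i # 0# → Member W (x i · w i)
    go i (inj₁ xi≈0) = resp W (λ j → sym (trans (*-congʳ xi≈0) (zeroˡ (w i j)))) (0-closed W)
    go i (inj₂ xi#0) = ·-closed W (x i) (w∈W i xi#0)

  ⟨⟩-⊑ : {K : Set} {P : K → Point} (W : Subspace) → (∀ κ → P κ ∈ₚ W) → ⟨ P ⟩ ⊑ W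
  ⟨⟩-⊑ W P∈W (generator κ)  = P∈W κ
  ⟨⟩-⊑ W P∈W (g-resp eq v)  = resp W eq (⟨⟩-⊑ W P∈W v)
  ⟨⟩-⊑ W P∈W g-0            = 0-closed W
  ⟨⟩-⊑ W P∈W (g-+ v w)      = +-closed W (⟨⟩-⊑ W P∈W v) (⟨⟩-⊑ W P∈W w)
  ⟨⟩-⊑ W P∈W (g-· a v)      = ·-closed W a (⟨⟩-⊑ W P∈W v)

  -- Membership carries a coordinate vector, which `Generated` does not expose; `⟨⟩-⊑` translates
  -- from one to the other.
  span : ∀ {k} → (Fin k → 𝕍) → Subspace
  span w = record
    { Member   = λ v → ∃ λ x → ∀ j → v j ≈ lin x w j
    ; resp     = λ { eq (x , v≈) → x , λ j → trans (sym (eq j)) (v≈ j) }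
    ; 0-closed = (λ _ → 0#) , λ j → sym (lin-zeroˡ w (λ _ → ≈-refl) j)
    ; +-closed = λ { (x , v≈) (y , u≈) → (λ i → x i + y i) ,
                     λ j → trans (+-cong (v≈ j) (u≈ j)) (sym (lin-+ˡ w x y j)) }
    ; ·-closed = λ { a (x , v≈) → (λ i → a * x i) ,
                     λ j → trans (*-congˡ (v≈ j)) (sym (lin-*ˡ w a x j)) }
    }

  -- The span of the differences of the vectors `w i`. Taken over all vertices of A it will be the
  -- hyperplane of the theorem, taken over `I` the intersection of the spaces on `I`.
  zeroSum : ∀ {k} → (Fin k → 𝕍) → Subspace
  zeroSum {k} w = record
    { Member   = λ v → ∃ λ x → sum x ≈ 0# × (∀ j → v j ≈ lin x w j)
    ; resp     = λ { eq (x , Σx , v≈) → x , Σx , λ j → trans (sym (eq j)) (v≈ j) }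
    ; 0-closed = (λ _ → 0#) , sum-replicate-zero k ,
                 λ j → sym (lin-zeroˡ w (λ _ → ≈-refl) j)
    ; +-closed = λ { (x , Σx , v≈) (y , Σy , u≈) → (λ i → x i + y i) ,
                     trans (∑-distrib-+ x y) (trans (+-cong Σx Σy) (+-identityˡ 0#)) ,
                     λ j → trans (+-cong (v≈ j) (u≈ j)) (sym (lin-+ˡ w x y j)) }
    ; ·-closed = λ { a (x , Σx , v≈) → (λ i → a * x i) ,
                     trans (sym (*-distribˡ-sum a x)) (trans (*-congˡ Σx) (zeroʳ a)) ,
                     λ j → trans (*-congˡ (v≈ j)) (sym (lin-*ˡ w a x j)) }
    }

  zeroSum-members-⊑ : ∀ {k} (w : Fin k → 𝕍) I → zeroSum (w ∘ members I) ⊑ zeroSum w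
  zeroSum-members-⊑ w I (z , Σz≈0 , v≈) =
    extend I z , trans (sum-extend I z) Σz≈0 , λ j → trans (v≈ j) (sym (lin-extend I z w j))

  Ind⇒Independent : ∀ {k} (P : Fin k → Point) → Ind (vec ∘ P) → Independent P
  Ind⇒Independent P ind a aP≈0 = ind a λ j → trans (reflexive (lin-def a (vec ∘ P) j)) (aP≈0 j)

  HasDim-resp : ∀ {U W d} → U ≐ W → HasDim W d → HasDim U d
  HasDim-resp (U⊑W , W⊑U) (P , ind , W⊑P , P⊑W) =
    P , ind , (λ v∈U → W⊑P (U⊑W v∈U)) , λ v∈P → W⊑U (P⊑W v∈P)

  -- The differences of `e zero` with the other vectors form a basis: `suc (suc d)` vectors give
  -- `suc d` differences, hence projective dimension `d`.
  HasDim-zeroSum : ∀ {k} (e : Fin k → 𝕍) → Ind e → ∀ {d} → k ≡ suc (suc d) → HasDim (zeroSum e) d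
  HasDim-zeroSum e ind {d} refl =
    D , Ind⇒Independent D Ind-diff , zeroSum⊑D , ⟨⟩-⊑ (zeroSum e) D∈zeroSum
    where
    -- Written as a translate by `e zero`, so that `lin-translate` applies.
    diff : Fin (suc d) → 𝕍
    diff k j = - e (suc k) j + e zero j

    lin-diff : ∀ a j → lin a diff j ≈ lin (sum a ∷ λ k → - a k) e j
    lin-diff a j = begin
      lin a diff j
        ≈⟨ lin-translate (λ k j → - e (suc k) j) a (e zero) j ⟩
      lin a (λ k j → - e (suc k) j) j + sum a * e zero j
        ≈⟨ +-congʳ (lin-neg (e ∘ suc) a j) ⟨
      lin (λ k → - a k) (e ∘ suc) j + sum a * e zero j
        ≈⟨ +-comm _ _ ⟩
      sum a * e zero j + lin (λ k → - a k) (e ∘ suc) j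
        ≈⟨ lin-suc (sum a ∷ λ k → - a k) e j ⟨
      lin (sum a ∷ λ k → - a k) e j ∎

    Ind-diff : Ind diff
    Ind-diff a a≈0 k = -x≈0⇒x≈0 (ind _ (λ j → trans (sym (lin-diff a j)) (a≈0 j)) (suc k))

    D : Fin (suc d) → Point
    D k = point (diff k) (Ind⇒nonzero Ind-diff k)

    D∈zeroSum : ∀ k → D k ∈ₚ zeroSum e
    D∈zeroSum k = (sum (δ k) ∷ λ l → - δ k l)
      , trans (+-congˡ (sum-neg (δ k))) (-‿inverseʳ _)
      , λ j → trans (sym (lin-δ diff k j)) (lin-diff (δ k) j)

    zeroSum⊑D : zeroSum e ⊑ ⟨ D ⟩
    zeroSum⊑D (z , Σz≈0 , v≈) = g-resp
      (λ j → trans (lin-diff a j) (trans (lin-congˡ e eq j) (sym (v≈ j))))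
      (lin-member ⟨ D ⟩ a diff λ k → g-· (a k) (generator k))
      where
      -- The sign compensates for `diff` subtracting `e (suc k)`; the coefficient at `e zero` then
      -- agrees because `z` has sum zero.
      a : Vector Carrier (suc d)
      a k = - z (suc k)
      eq : ∀ i → (sum a ∷ λ k → - a k) i ≈ z i
      eq zero    = trans (sum-neg (z ∘ suc)) (sym (+-inverseˡ-unique _ _ Σz≈0))
      eq (suc k) = -‿involutive _

  -- Vectors representing a point

  proportional : ∀ {P Q a} → (∀ j → vec P j ≈ a * vec Q j) → P ≈ₚ Q
  proportional {P} {Q} {a} eq = a , ≉0⇒#0 a≉0 , eq
    where
    a≉0 : ¬ (a ≈ 0#)
    a≉0 a≈0 = nonzero P λ j → trans (eq j) (trans (*-congʳ a≈0) (zeroˡ _))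

  HasDim0⇒∃! : ∀ {W} → HasDim W 0 → ∃! _≈ₚ_ (_∈ₚ W)
  HasDim0⇒∃! {W} (P , _ , W⊑P , P⊑W) = P zero , P⊑W (generator zero) , λ {Q} → unique {Q}
    where
    unique : ∀ {Q} → Q ∈ₚ W → P zero ≈ₚ Q
    unique {Q} Q∈W
      with ⟨⟩-⊑ (span (vec ∘ P)) (λ k → δ k , λ j → sym (lin-δ (vec ∘ P) k j)) (W⊑P Q∈W)
    ... | x , Q≈xP = Setoid.sym pointSetoid {Q} {P zero} (proportional {Q} {P zero} {x zero} λ j → begin
      vec Q j                          ≈⟨ Q≈xP j ⟩
      lin x (vec ∘ P) j                ≈⟨ lin-suc x (vec ∘ P) j ⟩
      x zero * vec (P zero) j + lin (x ∘ suc) (vec ∘ P ∘ suc) j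
                                       ≈⟨ +-congˡ (lin-zeroˡ (vec ∘ P ∘ suc) (λ ()) j) ⟩
      x zero * vec (P zero) j + 0#     ≈⟨ +-identityʳ _ ⟩
      x zero * vec (P zero) j          ∎)

  infix 4 _∝_

  -- Says that `v` is another representative of `P`. Multiples in both directions take the place of
  -- a scalar apart from zero.
  _∝_ : Point → 𝕍 → Set (c ⊔ ℓ₁)
  P ∝ v = (∃ λ a → ∀ j → vec P j ≈ a * v j) × (∃ λ a → ∀ j → v j ≈ a * vec P j)

  scaled : ∀ {P v a} → a # 0# → (∀ j → v j ≈ a * vec P j) → P ∝ v
  scaled {P} {v} {a} a#0 v≈aP with inverse a#0
  ... | a⁻¹ , a⁻¹a≈1 = (a⁻¹ , P≈a⁻¹v) , (a , v≈aP)
    where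
    P≈a⁻¹v : ∀ j → vec P j ≈ a⁻¹ * v j
    P≈a⁻¹v j = begin
      vec P j                ≈⟨ *-identityˡ _ ⟨
      1# * vec P j           ≈⟨ *-congʳ a⁻¹a≈1 ⟨
      a⁻¹ * a * vec P j      ≈⟨ *-assoc _ _ _ ⟩
      a⁻¹ * (a * vec P j)    ≈⟨ *-congˡ (v≈aP j) ⟨
      a⁻¹ * v j              ∎

  -- Coordinates with respect to a simplex

  space⊑span : ∀ {A : Fin (suc n) → Point} {w} → (∀ i → A i ∝ w i) →
    ∀ I → space A I ⊑ span (w ∘ members I)
  space⊑span {A} {w} A∝w I = ⟨⟩-⊑ (span (w ∘ members I)) generator∈
    where
    generator∈ : ∀ ((i , _) : ∃ (_∈ I)) → A i ∈ₚ span (w ∘ members I)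
    generator∈ (i , i∈I) with ∈-members i∈I | A∝w i
    ... | k , refl | (a , A≈aw) , _ = resp (span (w ∘ members I)) (λ j → sym (A≈aw j))
      (·-closed (span (w ∘ members I)) a (δ k , λ j → sym (lin-δ (w ∘ members I) k j)))

  ∝⇒∈space : ∀ {A : Fin (suc n) → Point} {w : Fin (suc n) → 𝕍} → (∀ i → A i ∝ w i) →
    ∀ I {i} → i ∈ I → Member (space A I) (w i)
  ∝⇒∈space {A} A∝w I {i} i∈I with A∝w i
  ... | _ , a , w≈aA = g-resp (λ j → sym (w≈aA j)) (g-· a (generator (i , i∈I)))

  simplex-spans : ∀ {A : Fin (suc n) → Point} {w} → IsSimplex A → (∀ i → A i ∝ w i) →
    ∀ P → P ∈ₚ span w
  simplex-spans {A} {w} A-simplex A∝w P = ⟨⟩-⊑ (span w) generator∈ (IsSimplex.generates A-simplex P)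
    where
    generator∈ : ∀ i → A i ∈ₚ span w
    generator∈ i with A∝w i
    ... | (a , A≈aw) , _ = resp (span w) (λ j → sym (A≈aw j))
      (·-closed (span w) a (δ i , λ j → sym (lin-δ w i j)))

  -- The vertices generate every point, in particular the unit vectors, and `suc n` vectors spanning
  -- a space of that rank are independent.
  simplex-Ind : ∀ {A : Fin (suc n) → Point} {w} → IsSimplex A → (∀ i → A i ∝ w i) → Ind w
  simplex-Ind {w = w} A-simplex A∝w = spanning⇒Ind w λ i →
    simplex-spans A-simplex A∝w (point (δ i) λ δ≈0 →
      #⇒≉ 1#0 (trans (reflexive (≡-sym (δ-diagonal i))) (δ≈0 i)))

  -- Linear relations between points

  dependent⇒≈ₚ : ∀ {P Q a b} → (∀ j → a * vec P j + b * vec Q j ≈ 0#) → a # 0# ⊎ b # 0# → P ≈ₚ Q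
  dependent⇒≈ₚ {P} {Q} {a} {b} dep a#0⊎b#0 with ≈0⊎#0 a | a#0⊎b#0
  ... | inj₁ a≈0 | inj₁ a#0 = contradiction a≈0 (#⇒≉ a#0)
  -- With `a` zero the relation would make `Q` the zero vector.
  ... | inj₁ a≈0 | inj₂ b#0 = contradiction
    (λ j → *-cancel-#0 b#0 (begin
      b * vec Q j                  ≈⟨ +-identityˡ _ ⟨
      0# + b * vec Q j             ≈⟨ +-congʳ (trans (*-congʳ a≈0) (zeroˡ _)) ⟨
      a * vec P j + b * vec Q j    ≈⟨ dep j ⟩
      0#                           ∎))
    (nonzero Q)
  ... | inj₂ a#0 | _ with inverse a#0
  ...   | a⁻¹ , a⁻¹a≈1 = proportional {P} {Q} {a⁻¹ * - b} λ j → begin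
      vec P j                    ≈⟨ *-identityˡ _ ⟨
      1# * vec P j               ≈⟨ *-congʳ a⁻¹a≈1 ⟨
      a⁻¹ * a * vec P j          ≈⟨ *-assoc _ _ _ ⟩
      a⁻¹ * (a * vec P j)        ≈⟨ *-congˡ (+-inverseˡ-unique _ _ (dep j)) ⟩
      a⁻¹ * - (b * vec Q j)      ≈⟨ *-congˡ (-‿distribˡ-* b (vec Q j)) ⟩
      a⁻¹ * (- b * vec Q j)      ≈⟨ *-assoc _ _ _ ⟨
      a⁻¹ * - b * vec Q j        ∎

  -- On the basis of a line the three points have coordinates in a plane of vectors, where any three
  -- vectors are dependent.
  collinear⇒dependent : ∀ {L} → HasDim L 1 → ∀ {P Q R} → P ∈ₚ L → Q ∈ₚ L → R ∈ₚ L →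
    ∃ λ a → (∀ j → lin a (vec P ∷ vec Q ∷ vec R ∷ []) j ≈ 0#) × ∃ λ i → a i # 0#
  collinear⇒dependent {L} (G , _ , L⊑G , _) {P} {Q} {R} P∈L Q∈L R∈L
    with inSpan P∈L | inSpan Q∈L | inSpan R∈L
    where
    inSpan : ∀ {v} → Member L v → Member (span (vec ∘ G)) v
    inSpan v∈L = ⟨⟩-⊑ (span (vec ∘ G)) (λ k → δ k , λ j → sym (lin-δ (vec ∘ G) k j)) (L⊑G v∈L)
  ... | x , P≈ | y , Q≈ | z , R≈ with dependency (x ∷ y ∷ z ∷ [])
  ...   | a , dep , i , ai#0 = a , vanish , i , ai#0
    where
    N : Fin 3 → Vector Carrier 2
    N = x ∷ y ∷ z ∷ []
    combination : ∀ k j → (vec P ∷ vec Q ∷ vec R ∷ []) k j ≈ lin (N k) (vec ∘ G) j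
    combination zero             = P≈
    combination (suc zero)       = Q≈
    combination (suc (suc zero)) = R≈
    vanish : ∀ j → lin a (vec P ∷ vec Q ∷ vec R ∷ []) j ≈ 0#
    vanish j = begin
      lin a (vec P ∷ vec Q ∷ vec R ∷ []) j
        ≈⟨ lin-congʳ (vec P ∷ vec Q ∷ vec R ∷ []) a combination j ⟩
      lin a (λ k → lin (N k) (vec ∘ G)) j
        ≈⟨ lin-lin (vec ∘ G) a N j ⟩
      lin (lin a N) (vec ∘ G) j
        ≈⟨ lin-zeroˡ (vec ∘ G) dep j ⟩
      0# ∎

  -- The points satisfy a relation `x V + b P + d Q = 0`. None of its coefficients vanishes, since
  -- two of the points would then coincide. Division by `x` makes `(b/x) P` the vector `c`, and
  -- `c + V` becomes `-(d/x) Q`.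
  normalize-collinear : ∀ {L} → HasDim L 1 → ∀ {V P Q} → V ∈ₚ L → P ∈ₚ L → Q ∈ₚ L →
    ¬ (V ≈ₚ P) → ¬ (V ≈ₚ Q) → ¬ (P ≈ₚ Q) → ∃ λ c → P ∝ c × Q ∝ (λ j → c j + vec V j)
  normalize-collinear {L} L-line {V} {P} {Q} V∈L P∈L Q∈L V≉P V≉Q P≉Q
    with collinear⇒dependent {L} L-line {V} {P} {Q} V∈L P∈L Q∈L
  ... | a , vanish , i , ai#0 = c′ , scaled {P} (x#0y#0→xy#0 q#0 b#0) (λ j → ≈-refl)
                              , scaled {Q} (≉0⇒#0 (#⇒≉ (x#0y#0→xy#0 q#0 d#0) ∘ -x≈0⇒x≈0)) Q≈
    where
    x = a zero
    b = a (suc zero)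
    d = a (suc (suc zero))
    dep : ∀ j → x * vec V j + (b * vec P j + d * vec Q j) ≈ 0#
    dep j = trans (sym (lin-three a (vec V) (vec P) (vec Q) j)) (vanish j)
    drop : ∀ {r} → r ≈ 0# → ∀ s → r * s ≈ 0#
    drop r≈0 s = trans (*-congʳ r≈0) (zeroˡ s)
    nonzero₂ : ∀ {r s t} → r ≈ 0# → r # 0# ⊎ s # 0# ⊎ t # 0# → s # 0# ⊎ t # 0#
    nonzero₂ r≈0 (inj₁ r#0) = contradiction r≈0 (#⇒≉ r#0)
    nonzero₂ r≈0 (inj₂ rest) = rest
    x#0⊎b#0⊎d#0 : x # 0# ⊎ b # 0# ⊎ d # 0#
    x#0⊎b#0⊎d#0 = cases i ai#0
      where
      cases : ∀ i → a i # 0# → x # 0# ⊎ b # 0# ⊎ d # 0#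
      cases zero             h = inj₁ h
      cases (suc zero)       h = inj₂ (inj₁ h)
      cases (suc (suc zero)) h = inj₂ (inj₂ h)
    -- The coefficient of `V` comes first: it then serves as the coefficient apart from zero in the
    -- two other cases.
    x#0 : x # 0#
    x#0 = ≉0⇒#0 λ x≈0 → P≉Q (dependent⇒≈ₚ {P} {Q}
      (λ j → trans (sym (trans (+-congʳ (drop x≈0 _)) (+-identityˡ _))) (dep j))
      (nonzero₂ x≈0 x#0⊎b#0⊎d#0))
    b#0 : b # 0#
    b#0 = ≉0⇒#0 λ b≈0 → V≉Q (dependent⇒≈ₚ {V} {Q}
      (λ j → trans (+-congˡ (sym (trans (+-congʳ (drop b≈0 _)) (+-identityˡ _)))) (dep j))
      (inj₁ x#0))
    d#0 : d # 0#
    d#0 = ≉0⇒#0 λ d≈0 → V≉P (dependent⇒≈ₚ {V} {P}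
      (λ j → trans (+-congˡ (sym (trans (+-congˡ (drop d≈0 _)) (+-identityʳ _)))) (dep j))
      (inj₁ x#0))
    q : Carrier
    q = proj₁ (inverse x#0)
    q#0 : q # 0#
    q#0 = ≉0⇒#0 λ q≈0 → #⇒≉ 1#0 (trans (sym (proj₂ (inverse x#0))) (drop q≈0 x))
    c′ : 𝕍
    c′ j = q * b * vec P j
    Q≈ : ∀ j → c′ j + vec V j ≈ - (q * d) * vec Q j
    Q≈ j = trans (+-inverseˡ-unique _ _ (begin
      q * b * vec P j + vec V j + q * d * vec Q j
        ≈⟨ +-cong (+-comm _ _) (*-assoc q d _) ⟩
      vec V j + q * b * vec P j + q * (d * vec Q j)
        ≈⟨ +-congʳ (+-cong (trans (sym (*-identityˡ _)) (*-congʳ (sym (proj₂ (inverse x#0)))))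
                           (*-assoc q b _)) ⟩
      q * x * vec V j + q * (b * vec P j) + q * (d * vec Q j)
        ≈⟨ +-assoc _ _ _ ⟩
      q * x * vec V j + (q * (b * vec P j) + q * (d * vec Q j))
        ≈⟨ +-cong (*-assoc q x _) (sym (distribˡ q _ _)) ⟩
      q * (x * vec V j) + q * (b * vec P j + d * vec Q j)
        ≈⟨ distribˡ q _ _ ⟨
      q * (x * vec V j + (b * vec P j + d * vec Q j))
        ≈⟨ *-congˡ (dep j) ⟩
      q * 0#
        ≈⟨ zeroʳ q ⟩
      0# ∎)) (-‿distribˡ-* (q * d) (vec Q j))

  -- By uniqueness of coordinates the coefficients of `P` would be `a` at `i` and 0 elsewhere. Their
  -- sum is `a`, so `a` vanishes and `P` would be the zero vector.
  zeroSum∌multiple : ∀ {k} {e : Fin k → 𝕍} → Ind e → ∀ {P} → P ∈ₚ zeroSum e →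
    ∀ {i a} → ¬ (∀ j → vec P j ≈ a * e i j)
  zeroSum∌multiple {e = e} ind {P} (x , Σx≈0 , P≈xe) {i} {a} P≈aeᵢ = nonzero P λ j → begin
    vec P j     ≈⟨ P≈aeᵢ j ⟩
    a * e i j   ≈⟨ *-congʳ a≈0 ⟩
    0# * e i j  ≈⟨ zeroˡ _ ⟩
    0#          ∎
    where
    x≈aδ : ∀ l → x l ≈ a * δ i l
    x≈aδ = Ind⇒unique ind λ j → begin
      lin x e j                  ≈⟨ P≈xe j ⟨
      vec P j                    ≈⟨ P≈aeᵢ j ⟩
      a * e i j                  ≈⟨ *-congˡ (lin-δ e i j) ⟨
      a * lin (δ i) e j          ≈⟨ lin-*ˡ e a (δ i) j ⟨
      lin (λ l → a * δ i l) e j  ∎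
    a≈0 : a ≈ 0#
    a≈0 = begin
      a                          ≈⟨ sum-δ-* i (λ _ → a) ⟨
      sum (λ l → δ i l * a)      ≈⟨ sum-cong-≋ (λ l → *-comm (δ i l) a) ⟩
      sum (λ l → a * δ i l)      ≈⟨ sum-cong-≋ x≈aδ ⟨
      sum x                      ≈⟨ Σx≈0 ⟩
      0#                         ∎

  ≈ₚ-∝ : ∀ {P Q v} → P ≈ₚ Q → Q ∝ v → ∃ λ a → ∀ j → vec P j ≈ a * v j
  ≈ₚ-∝ (a , _ , P≈aQ) ((α , Q≈αv) , _) = a * α , λ j →
    trans (P≈aQ j) (trans (*-congˡ (Q≈αv j)) (sym (*-assoc a α _)))

  -- Perspective simplexes in normalized coordinates

  module Perspective {A B : Fin (suc n) → Point}
    (A-simplex : IsSimplex A) (B-simplex : IsSimplex B) (V : Point)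
    (w : Fin (suc n) → 𝕍) (A∝w : ∀ i → A i ∝ w i) (B∝w+V : ∀ i → B i ∝ (λ j → w i j + vec V j))
    where

    b : Fin (suc n) → 𝕍
    b i j = w i j + vec V j

    w-Ind : Ind w
    w-Ind = simplex-Ind A-simplex A∝w

    b-Ind : Ind b
    b-Ind = simplex-Ind B-simplex B∝w+V

    s : Vector Carrier (suc n)
    s = proj₁ (simplex-spans A-simplex A∝w V)

    V≈sw : ∀ j → vec V j ≈ lin s w j
    V≈sw = proj₂ (simplex-spans A-simplex A∝w V)

    module _ {i} (sᵢ≈0 : s i ≈ 0#) where

      private
        I = ∁ ⁅ i ⁆

        ≢⇒∈I : ∀ {k} → k ≢ i → k ∈ I
        ≢⇒∈I k≢i = x∉p⇒x∈∁p (k≢i ∘ x∈⁅y⁆⇒x≡y i)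

        ∈I⇒≢ : ∀ {k} → k ∈ I → k ≢ i
        ∈I⇒≢ k∈I refl = x∈∁p⇒x∉p k∈I (x∈⁅x⁆ i)

      -- Since its coordinate at `i` vanishes, `V` lies in this face of A, and so does each
      -- `w k + V` with `k` in `I`.
      face-B⊑face-A : space B I ⊑ space A I
      face-B⊑face-A = ⟨⟩-⊑ (space A I) generator∈
        where
        V∈A : V ∈ₚ space A I
        V∈A = g-resp (λ j → sym (V≈sw j)) (lin-member′ (space A I) s w λ k sₖ#0 →
          ∝⇒∈space A∝w I (≢⇒∈I λ { refl → #⇒≉ sₖ#0 sᵢ≈0 }))
        generator∈ : ∀ ((k , _) : ∃ (_∈ I)) → B k ∈ₚ space A I
        generator∈ (k , k∈I) with B∝w+V k
        ... | (β , B≈βb) , _ = g-resp (λ j → sym (B≈βb j))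
          (g-· β (g-+ (∝⇒∈space A∝w I k∈I) V∈A))

      -- In an expansion of `A k` over `b` with coefficients `y`, the coordinate at `w i` is
      -- `y i + sum y * s i`. It is zero because `k` differs from `i`, and `s i` being zero leaves
      -- `y i` zero.
      face-A⊑face-B : space A I ⊑ space B I
      face-A⊑face-B = ⟨⟩-⊑ (space B I) generator∈
        where
        generator∈ : ∀ ((k , _) : ∃ (_∈ I)) → A k ∈ₚ space B I
        generator∈ (k , k∈I) with A∝w k | simplex-spans B-simplex B∝w+V (A k)
        ... | (α , A≈αw) , _ | y , A≈yb = g-resp (λ j → sym (A≈yb j))
          (lin-member′ (space B I) y b λ l yₗ#0 →
            ∝⇒∈space B∝w+V I (≢⇒∈I λ { refl → #⇒≉ yₗ#0 yᵢ≈0 }))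
          where
          yᵢ≈0 : y i ≈ 0#
          yᵢ≈0 = begin
            y i                    ≈⟨ +-identityʳ _ ⟨
            y i + 0#               ≈⟨ +-congˡ (trans (*-congˡ sᵢ≈0) (zeroʳ _)) ⟨
            y i + sum y * s i
              ≈⟨ Ind⇒unique w-Ind (λ j → begin
                lin (λ l → y l + sum y * s l) w j   ≈⟨ lin-translate-span V≈sw y j ⟨
                lin y b j                           ≈⟨ A≈yb j ⟨
                vec (A k) j                         ≈⟨ A≈αw j ⟩
                α * w k j                           ≈⟨ *-congˡ (lin-δ w k j) ⟨
                α * lin (δ k) w j                   ≈⟨ lin-*ˡ w α (δ k) j ⟨
                lin (λ l → α * δ k l) w j           ∎) i ⟩
            α * δ k i              ≈⟨ *-congˡ (reflexive (δ-off-diagonal (∈I⇒≢ k∈I))) ⟩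
            α * 0#                 ≈⟨ zeroʳ α ⟩
            0#                     ∎

    -- Intersections of corresponding spaces

    module NoCommonFace
      (no-common-face : ∀ I J → ∣ I ∣ ≡ n → ∣ J ∣ ≡ n → ¬ (space A I ≐ space B J)) where

      -- Otherwise the faces opposite the vertices of index `i` would coincide.
      s#0 : ∀ i → s i # 0#
      s#0 i = ≉0⇒#0 {s i} λ sᵢ≈0 →
        no-common-face (∁ ⁅ i ⁆) (∁ ⁅ i ⁆) (∣∁⁅x⁆∣≡n i) (∣∁⁅x⁆∣≡n i)
          ((λ {v} → face-A⊑face-B {i} sᵢ≈0 {v}) , (λ {v} → face-B⊑face-A {i} sᵢ≈0 {v}))

      meet : Subset (suc n) → Subspace
      meet I = space A I ⊓ space B I

      -- The expansions over `w` and over `b` are compared at an index `i` outside `I`. Both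
      -- extended coefficient families vanish there, which leaves `sum y * s i` equal to zero, and
      -- `s i` can be cancelled.
      meet-coordinates : ∀ {I} → ∣ I ∣ < suc n → ∀ {v} → Member (meet I) v →
        ∃ λ y → sum y ≈ 0# × (∀ j → v j ≈ lin y (w ∘ members I) j)
                           × (∀ j → v j ≈ lin y (b ∘ members I) j)
      meet-coordinates {I} ∣I∣≤n {v} (v∈A , v∈B) = y , Σy≈0 , v≈yw , v≈yb
        where
        v∈w = space⊑span {A} {w} A∝w I v∈A
        v∈b = space⊑span {B} {b} B∝w+V I v∈B
        z = proj₁ v∈w
        v≈zw = proj₂ v∈w
        y = proj₁ v∈b
        v≈yb = proj₂ v∈b
        i = proj₁ (missing-element I ∣I∣≤n)
        i∉I = proj₂ (missing-element I ∣I∣≤n)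
        x̂ = extend I z
        ŷ = extend I y
        yᵢ+Σy*sᵢ≈zᵢ : ∀ i → ŷ i + sum ŷ * s i ≈ x̂ i
        yᵢ+Σy*sᵢ≈zᵢ = Ind⇒unique w-Ind λ j → begin
          lin (λ l → ŷ l + sum ŷ * s l) w j   ≈⟨ lin-translate-span V≈sw ŷ j ⟨
          lin ŷ b j                           ≈⟨ lin-extend I y b j ⟩
          lin y (b ∘ members I) j             ≈⟨ v≈yb j ⟨
          v j                                 ≈⟨ v≈zw j ⟩
          lin z (w ∘ members I) j             ≈⟨ lin-extend I z w j ⟨
          lin x̂ w j                           ∎
        Σy≈0 : sum y ≈ 0#
        Σy≈0 = *-cancel-#0 (s#0 i) (begin
          s i * sum y            ≈⟨ *-comm _ _ ⟩
          sum y * s i            ≈⟨ *-congʳ (sum-extend I y) ⟨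
          sum ŷ * s i            ≈⟨ +-identityˡ _ ⟨
          0# + sum ŷ * s i       ≈⟨ +-congʳ (reflexive (extend-∉ I y i∉I)) ⟨
          ŷ i + sum ŷ * s i      ≈⟨ yᵢ+Σy*sᵢ≈zᵢ i ⟩
          x̂ i                    ≈⟨ reflexive (extend-∉ I z i∉I) ⟩
          0#                     ∎)
        v≈yw : ∀ j → v j ≈ lin y (w ∘ members I) j
        v≈yw j = trans (v≈yb j) (lin-translate-zeroSum (w ∘ members I) Σy≈0 (vec V) j)

      meet≐zeroSum : ∀ {I} → ∣ I ∣ < suc n → meet I ≐ zeroSum (w ∘ members I)
      meet≐zeroSum {I} ∣I∣≤n = to , from
        where
        to : ∀ {v} → Member (meet I) v → Member (zeroSum (w ∘ members I)) v
        to {v} v∈meet = let y , Σy≈0 , v≈yw , _ = meet-coordinates {I} ∣I∣≤n {v} v∈meet in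
          y , Σy≈0 , v≈yw
        from : ∀ {v} → Member (zeroSum (w ∘ members I)) v → Member (meet I) v
        from {v} (y , Σy≈0 , v≈yw) =
          resp (space A I) {lin y (w ∘ members I)} {v} (λ j → sym (v≈yw j))
            (lin-member (space A I) y (w ∘ members I) λ k →
              ·-closed (space A I) (y k) (∝⇒∈space {A} {w} A∝w I (members-∈ I k))) ,
          resp (space B I) {lin y (b ∘ members I)} {v}
            (λ j → trans (lin-translate-zeroSum (w ∘ members I) Σy≈0 (vec V) j) (sym (v≈yw j)))
            (lin-member (space B I) y (b ∘ members I) λ k →
              ·-closed (space B I) (y k) (∝⇒∈space {B} {b} B∝w+V I (members-∈ I k)))

      -- Serves edges (`d = 0`), `t`-spaces (`d = t - 1`) and faces (`d = n - 2`) alike.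
      HasDim-meet : ∀ {I d} → ∣ I ∣ ≡ suc (suc d) → ∣ I ∣ < suc n → HasDim (meet I) d
      HasDim-meet {I} ∣I∣≡ ∣I∣≤n =
        HasDim-resp {meet I} {zeroSum (w ∘ members I)} (meet≐zeroSum {I} ∣I∣≤n)
          (HasDim-zeroSum (w ∘ members I) (Ind-members w-Ind I) ∣I∣≡)

      -- Extension by zero preserves the coefficient sum, so one hyperplane serves every `I`.
      meet⊑hyperplane : ∀ {I} → ∣ I ∣ < suc n → meet I ⊑ zeroSum w
      meet⊑hyperplane {I} ∣I∣≤n {v} v∈meet =
        zeroSum-members-⊑ w I {v} (proj₁ (meet≐zeroSum {I} ∣I∣≤n) {v} v∈meet)

      module _ {I} (∣I∣≤n : ∣ I ∣ < suc n) {P} (P∈meet : P ∈ₚ meet I) where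

        P-coordinates = meet-coordinates {I} ∣I∣≤n {vec P} P∈meet

        meet∌A : ∀ i → ¬ (P ≈ₚ A i)
        meet∌A i P≈Aᵢ = zeroSum∌multiple w-Ind {P} (meet⊑hyperplane {I} ∣I∣≤n {vec P} P∈meet)
          (proj₂ (≈ₚ-∝ {P} {A i} P≈Aᵢ (A∝w i)))

        -- The same coefficients write `P` as a zero-sum combination of `b`, so the argument for A
        -- carries over.
        meet∌B : ∀ i → ¬ (P ≈ₚ B i)
        meet∌B i P≈Bᵢ = let y , Σy≈0 , _ , P≈yb = P-coordinates in
          zeroSum∌multiple b-Ind {P} (zeroSum-members-⊑ b I (y , Σy≈0 , P≈yb))
            (proj₂ (≈ₚ-∝ {P} {B i} P≈Bᵢ (B∝w+V i)))

        -- `P` has coordinate zero at an index outside `I`, whereas every coordinate of `V` is apart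
        -- from zero.
        meet∌V : ¬ (P ≈ₚ V)
        meet∌V (a , a#0 , P≈aV) =
          let y , _ , P≈yw , _ = P-coordinates
              i , i∉I          = missing-element I ∣I∣≤n
          in #⇒≉ (x#0y#0→xy#0 a#0 (s#0 i)) (begin
          a * s i         ≈⟨ Ind⇒unique w-Ind (λ j → begin
                               lin (λ i → a * s i) w j       ≈⟨ lin-*ˡ w a s j ⟩
                               a * lin s w j                 ≈⟨ *-congˡ (V≈sw j) ⟨
                               a * vec V j                   ≈⟨ P≈aV j ⟨
                               vec P j                       ≈⟨ P≈yw j ⟩
                               lin y (w ∘ members I) j       ≈⟨ lin-extend I y w j ⟨
                               lin (extend I y) w j          ∎) i ⟩
          extend I y i    ≈⟨ reflexive (extend-∉ I y i∉I) ⟩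
          0#              ∎)

        -- At an index of `I` outside `J` the coordinate of `P` would vanish. Of its two
        -- coefficients, which sum to zero, both would then vanish, and `P` would be the zero
        -- vector.
        edge-⊆ : ∀ {J Q} → ∣ I ∣ ≡ 2 → ∣ J ∣ < suc n → Q ∈ₚ meet J → P ≈ₚ Q → I ⊆ J
        edge-⊆ {J} {Q} ∣I∣≡2 ∣J∣≤n Q∈meet (a , _ , P≈aQ) {i} i∈I = decidable-stable (i ∈? J) λ i∉J →
          let z , Σz≈0 , P≈zw , _ = P-coordinates
              y , _    , Q≈yw , _ = meet-coordinates {J} ∣J∣≤n {vec Q} Q∈meet
              zᵢ≈0 : extend I z i ≈ 0#
              zᵢ≈0 = begin
                extend I z i                    ≈⟨ Ind⇒unique w-Ind (λ j → begin
                  lin (extend I z) w j             ≈⟨ lin-extend I z w j ⟩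
                  lin z (w ∘ members I) j          ≈⟨ P≈zw j ⟨
                  vec P j                          ≈⟨ P≈aQ j ⟩
                  a * vec Q j                      ≈⟨ *-congˡ (Q≈yw j) ⟩
                  a * lin y (w ∘ members J) j      ≈⟨ *-congˡ (lin-extend J y w j) ⟨
                  a * lin (extend J y) w j         ≈⟨ lin-*ˡ w a (extend J y) j ⟨
                  lin (λ i → a * extend J y i) w j ∎) i ⟩
                a * extend J y i                ≈⟨ *-congˡ (reflexive (extend-∉ J y i∉J)) ⟩
                a * 0#                          ≈⟨ zeroʳ a ⟩
                0#                              ∎
              k , zₖ≈zᵢ = extend-∈ I z i∈I
          in nonzero P λ j → trans (P≈zw j)
            (lin-zeroˡ (w ∘ members I) (sum-pair≈0 ∣I∣≡2 z Σz≈0 {k} (trans (reflexive zₖ≈zᵢ) zᵢ≈0)) j)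

      opaque
        edge-point : ∀ {I} → ∣ I ∣ ≡ 2 → 2 < suc n → ∃! _≈ₚ_ (_∈ₚ meet I)
        edge-point {I} ∣I∣≡2 2≤n =
          HasDim0⇒∃! {meet I} (HasDim-meet {I} ∣I∣≡2 (≡-subst (_< suc n) (≡-sym ∣I∣≡2) 2≤n))

      -- Each edge is sent to its intersection point. Injectivity is `edge-⊆` used in both
      -- directions; surjectivity is the uniqueness of the intersection point.
      HasCardinality-edges : 2 < suc n → ∀ {N} → Fin N ↔ SubsetOfSize (suc n) 2 →
        HasCardinality (EdgeIntersection A B) N
      HasCardinality-edges 2≤n {N} enumeration = record
        { to        = pointOn ∘ edge
        ; cong      = λ { {x} refl → Setoid.refl pointSetoid {proj₁ (pointOn (edge x))} }
        ; bijective = (λ {x} {y} → injective x y) , surjective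
        }
        where
        open Inverse enumeration renaming (to to edge; from to index) using (strictlyInverseˡ)

        2⇒< : ∀ I → ∣ I ∣ ≡ 2 → ∣ I ∣ < suc n
        2⇒< I ∣I∣≡2 = ≡-subst (_< suc n) (≡-sym ∣I∣≡2) 2≤n

        pointOn : SubsetOfSize (suc n) 2 → ∃ (EdgeIntersection A B)
        pointOn (I , ∣I∣≡2) = let P , P∈meet , _ = edge-point {I} ∣I∣≡2 2≤n in
          P , I , ∣I∣≡2 , P∈meet

        pointOn-⊆ : ∀ X Y → proj₁ (pointOn X) ≈ₚ proj₁ (pointOn Y) → proj₁ X ⊆ proj₁ Y
        pointOn-⊆ X@(I , ∣I∣≡2) Y@(J , ∣J∣≡2) =
          edge-⊆ {I} (2⇒< I ∣I∣≡2) {proj₁ (pointOn X)} (proj₂ (proj₂ (proj₂ (pointOn X))))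
            {J} {proj₁ (pointOn Y)} ∣I∣≡2 (2⇒< J ∣J∣≡2) (proj₂ (proj₂ (proj₂ (pointOn Y))))

        injective : ∀ x y → proj₁ (pointOn (edge x)) ≈ₚ proj₁ (pointOn (edge y)) → x ≡ y
        injective x y P≈Q = Injection.injective (↔⇒↣ enumeration) (SubsetOfSize-≡ (⊆-antisym
          (pointOn-⊆ (edge x) (edge y) P≈Q)
          (pointOn-⊆ (edge y) (edge x) (Setoid.sym pointSetoid
            {proj₁ (pointOn (edge x))} {proj₁ (pointOn (edge y))} P≈Q))))

        surjective : ∀ (X : ∃ (EdgeIntersection A B)) →
          ∃ λ x → ∀ {z} → z ≡ x → proj₁ (pointOn (edge z)) ≈ₚ proj₁ X
        surjective (P , I , ∣I∣≡2 , P∈meet) = index (I , ∣I∣≡2) , λ { refl →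
          -- The enumeration gives back the edge only up to a propositional equality, so the claim
          -- is transported along it.
          ≡-subst (λ X → proj₁ (pointOn X) ≈ₚ P) (≡-sym (strictlyInverseˡ (I , ∣I∣≡2)))
            (proj₂ (proj₂ (edge-point {I} ∣I∣≡2 2≤n)) {P} P∈meet) }

-- Choice of the normalized vectors and assembly of (a) to (d)

theorem3p4 : ∀ {c ℓ₁ ℓ₂} (n : ℕ) → 2 ≤ n →
    (F : HeytingField c ℓ₁ ℓ₂) → Decidable (HeytingField._#_ F) → OrderGreaterThan2 F →
    let open ProjectiveSpace F n in
    (A B : Fin (suc n) → Point) → IsSimplex A → IsSimplex B →
    (V : Point) → InPerspective V A B →
    (∀ i → ¬ (V ≈ₚ A i)) → (∀ i → ¬ (V ≈ₚ B i)) →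
    (∀ i j → ¬ (A i ≈ₚ B j)) →
    (∀ I J → ∣ I ∣ ≡ n → ∣ J ∣ ≡ n → ¬ (space A I ≐ space B J)) →
    let S = EdgeIntersection A B in
    ( (∀ I → ∣ I ∣ ≡ 2 → ∃! _≈ₚ_ (λ P → P ∈ₚ (space A I ⊓ space B I)))
    × HasCardinality S (suc n C 2)
    × (∀ P → S P → (∀ i → ¬ (P ≈ₚ A i)) × (∀ i → ¬ (P ≈ₚ B i)) × ¬ (P ≈ₚ V)))
    × (∀ t → 1 ≤ t → t ≤ n ∸ 1 → ∀ I → ∣ I ∣ ≡ suc t →
    HasDim (space A I ⊓ space B I) (t ∸ 1))
    × (∃ λ (v : Subspace) → HasDim v (n ∸ 1)
    × (∀ I → ∣ I ∣ ≡ n →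
    HasDim (space A I ⊓ space B I) (n ∸ 2) × (space A I ⊓ space B I) ⊑ v)
    × (∀ P → S P → P ∈ₚ v))
theorem3p4 n@(suc (suc d)) (s≤s (s≤s z≤n)) F _#?_ _ A B A-simplex B-simplex V (L , incident)
  V≉A V≉B A≉B no-common-face =
    ( (λ I ∣I∣≡2 → edge-point {I} ∣I∣≡2 2<1+n)
    , HasCardinality-edges 2<1+n (enumerate (suc n) 2)
    , λ { P (I , ∣I∣≡2 , P∈meet) →
          let ∣I∣≤n = size< I ∣I∣≡2 2<1+n in
          meet∌A {I} ∣I∣≤n {P} P∈meet , meet∌B {I} ∣I∣≤n {P} P∈meet , meet∌V {I} ∣I∣≤n {P} P∈meet } )
  -- The dimension is `suc t` here: the subset has `suc (suc t)` elements, and the bound by `n ∸ 1`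
  -- leaves an index outside it.
  , (λ { (suc t) (s≤s z≤n) t<n I ∣I∣≡ → HasDim-meet {I} ∣I∣≡ (size< I ∣I∣≡ (s≤s (s≤s t<n))) })
  -- The fixed hyperplane, cut out by one condition on the coordinates over `w`.
  , zeroSum w
  , HasDim-zeroSum w w-Ind refl
  , (λ I ∣I∣≡n → HasDim-meet {I} ∣I∣≡n (size< I ∣I∣≡n (n<1+n n))
               , λ {v} → meet⊑hyperplane {I} (size< I ∣I∣≡n (n<1+n n)) {v})
  , λ { P (I , ∣I∣≡2 , P∈meet) → meet⊑hyperplane {I} (size< I ∣I∣≡2 2<1+n) {vec P} P∈meet }
  where
  open ProjectiveSpace F n
  open Geometry F _#?_ n

  2<1+n : 2 < suc n
  2<1+n = s≤s (s≤s (s≤s z≤n))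

  size< : ∀ I {k} → ∣ I ∣ ≡ k → k < suc n → ∣ I ∣ < suc n
  size< I ∣I∣≡k k<1+n = ≡-subst (_< suc n) (≡-sym ∣I∣≡k) k<1+n

  -- The line of index `i` carries the pairwise distinct points `V`, `A i` and `B i`, as the
  -- rescaling requires.
  normalize-collineard : ∀ i → ∃ λ w → A i ∝ w × B i ∝ (λ j → HeytingField._+_ F (w j) (vec V j))
  normalize-collineard i = let line , V∈L , A∈L , B∈L = incident i in
    normalize-collinear {L i} line {V} {A i} {B i} V∈L A∈L B∈L (V≉A i) (V≉B i) (A≉B i i)

  w : Fin (suc n) → 𝕍
  w i = proj₁ (normalize-collineard i)

  open Perspective A-simplex B-simplex V w
    (λ i → proj₁ (proj₂ (normalize-collineard i))) (λ i → proj₂ (proj₂ (normalize-collineard i)))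

  open NoCommonFace no-common-face
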